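{- There is an algorithm that, given a finite set $\mathcal U$ of unary predicate symbols, a $\mathcal U$-guarded first-order sentence $\varphi$ of quantifier rank at most $q$, and a symmetric relation $\mathcal R\subseteq\mathcal U\times\mathcal U$, computes a sentence $\varphi_{\mathcal R}$ such that for every graph $G$ and every interpretation of the predicates of $\mathcal U$ by subsets of $V(G)$ satisfying \[\mathcal R=\{(U,W)\in\mathcal U\times\mathcal U : U\cap W\neq\emptyset\text{ or some vertex of }U\text{ is adjacent in }G\text{ to some vertex of }W\},\] we have $G\langle\mathcal U\rangle\models\varphi\iff G\langle\mathcal U\rangle\models\varphi_{\mathcal R}$. Moreover, $\varphi_{\mathcal R}$ is a boolean combination of sentences of quantifier rank at most $q$, and each sentence occurring in it is $\mathcal U'$-guarded for some $\mathcal U'\subseteq\mathcal U$ such that the graph $(\mathcal U,\mathcal R)[\mathcal U']$ has diameter at most $2^q$. In particular, if each set of $\mathcal U$ is contained in an $r$-neighborhood $N_r[c]$ of $G$, then for each such $\mathcal U'$ the set $\bigcup\mathcal U'$ is contained in a subgraph of $G$ of diameter at most $(2r+1)(2^q+1)$.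
   Context: Graphs are finite, loopless, undirected, vertex-colored. Given a set $\mathcal U$ of unary predicates, a formula is $\mathcal U$-guarded if each of its quantifiers is of the form $\exists x\in U$ or $\forall x\in U$ (meaning $\exists x(U(x)\wedge\dots)$, $\forall x(U(x)\to\dots)$) for some $U\in\mathcal U$. $G\langle\mathcal U\rangle$ denotes $G$ expanded by the predicates of $\mathcal U$ with the given interpretations. $(\mathcal U,\mathcal R)$ is the graph with vertex set $\mathcal U$ and adjacency $\mathcal R$, and $(\mathcal U,\mathcal R)[\mathcal U']$ its induced subgraph on $\mathcal U'$. -}

module Defs where

open import Data.Bool using (Bool; T)
open import Data.Empty using (⊥)
open import Data.Fin using (Fin; zero)
open import Data.Fin.Subset using (Subset; _∈_; _∩_; Nonempty) renaming (⊤ to full)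
open import Data.Nat using (ℕ; suc; _⊔_; _≤_)
open import Data.Product using (∃-syntax; _×_)
open import Data.Sum using (_⊎_)
open import Data.Unit using (⊤)
open import Data.Vec using (Vec; []; _∷_; lookup)
open import Function.Bundles using (_⇔_)
open import Relation.Binary.Definitions using (Symmetric)
open import Relation.Binary.PropositionalEquality using (_≡_)
open import Relation.Nullary using (¬_)

BoolRel : ℕ → Set
BoolRel n = Fin n → Fin n → Bool

Holds : ∀ {n} → BoolRel n → Fin n → Fin n → Set
Holds E u v = T (E u v)

-- Colours are unary predicates: a vertex may carry any number of them.
record Graph (c : ℕ) : Set where
  field
    order    : ℕ
    adj      : BoolRel order
    adj-sym  : Symmetric (Holds adj)
    loopless : ∀ v → ¬ Holds adj v v
    colour   : Fin c → Subset order

open Graph public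

Vertex : ∀ {c} → Graph c → Set
Vertex G = Fin (order G)

-- Walk V E l u v: a walk of length l in the graph on V with adjacency E
-- restricted to V.
data Walk {n : ℕ} (V : Subset n) (E : BoolRel n) : ℕ → Fin n → Fin n → Set where
  here : ∀ {u} → u ∈ V → Walk V E 0 u u
  step : ∀ {l u v w} → u ∈ V → Holds E u v → Walk V E l v w → Walk V E (suc l) u w

Distance≤ : ∀ {n} → Subset n → BoolRel n → ℕ → Fin n → Fin n → Set
Distance≤ V E d u v = ∃[ l ] (l ≤ d × Walk V E l u v)

-- This entails connectedness. The graph without vertices satisfies it for every d.
Diameter≤ : ∀ {n} → Subset n → BoolRel n → ℕ → Set
Diameter≤ V E d = ∀ {u v} → u ∈ V → v ∈ V → Distance≤ V E d u v

-- v ∈ N_r[a]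
InNeighbourhood : ∀ {c} (G : Graph c) → ℕ → Vertex G → Vertex G → Set
InNeighbourhood G r a v = Distance≤ full (adj G) r a v

-- Not necessarily induced.
record Subgraph {c : ℕ} (G : Graph c) : Set where
  field
    vertices  : Subset (order G)
    edges     : BoolRel (order G)
    edges-sym : Symmetric (Holds edges)
    edges-end : ∀ {u v} → Holds edges u v → u ∈ vertices × v ∈ vertices
    edges-adj : ∀ {u v} → Holds edges u v → Holds (adj G) u v

open Subgraph public

-- First-order formulas with k free variables (de Bruijn indices) over
-- adjacency, equality, c colours and the m predicate symbols of 𝒰 = Fin m.
data Formula (c m : ℕ) (k : ℕ) : Set where
  true false    : Formula c m k
  _≐_ _~_       : Fin k → Fin k → Formula c m k
  col           : Fin c → Fin k → Formula c m k
  pred          : Fin m → Fin k → Formula c m k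
  not           : Formula c m k → Formula c m k
  _and_ _or_ _implies_ : Formula c m k → Formula c m k → Formula c m k
  ex all        : Formula c m (suc k) → Formula c m k

Sentence : ℕ → ℕ → Set
Sentence c m = Formula c m 0

rank : ∀ {c m k} → Formula c m k → ℕ
rank true          = 0
rank false         = 0
rank (x ≐ y)       = 0
rank (x ~ y)       = 0
rank (col C x)     = 0
rank (pred U x)    = 0
rank (not φ)       = rank φ
rank (φ and ψ)     = rank φ ⊔ rank ψ
rank (φ or ψ)      = rank φ ⊔ rank ψ
rank (φ implies ψ) = rank φ ⊔ rank ψ
rank (ex φ)        = suc (rank φ)
rank (all φ)       = suc (rank φ)

-- Only quantifiers are constrained: atoms may mention any symbol of 𝒰.
data Guarded {c m : ℕ} (𝒱 : Subset m) {k : ℕ} : Formula c m k → Set where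
  g-true    : Guarded 𝒱 true
  g-false   : Guarded 𝒱 false
  g-eq      : ∀ {x y} → Guarded 𝒱 (x ≐ y)
  g-edge    : ∀ {x y} → Guarded 𝒱 (x ~ y)
  g-col     : ∀ {C x} → Guarded 𝒱 (col C x)
  g-pred    : ∀ {U x} → Guarded 𝒱 (pred U x)
  g-not     : ∀ {φ} → Guarded 𝒱 φ → Guarded 𝒱 (not φ)
  g-and     : ∀ {φ ψ} → Guarded 𝒱 φ → Guarded 𝒱 ψ → Guarded 𝒱 (φ and ψ)
  g-or      : ∀ {φ ψ} → Guarded 𝒱 φ → Guarded 𝒱 ψ → Guarded 𝒱 (φ or ψ)
  g-implies : ∀ {φ ψ} → Guarded 𝒱 φ → Guarded 𝒱 ψ → Guarded 𝒱 (φ implies ψ)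
  g-ex      : ∀ {U φ} → U ∈ 𝒱 → Guarded 𝒱 φ → Guarded 𝒱 (ex (pred U zero and φ))
  g-all     : ∀ {U φ} → U ∈ 𝒱 → Guarded 𝒱 φ → Guarded 𝒱 (all (pred U zero implies φ))

data BooleanCombination {c m : ℕ} (P : Sentence c m → Set) : Sentence c m → Set where
  b-base    : ∀ {φ} → P φ → BooleanCombination P φ
  b-not     : ∀ {φ} → BooleanCombination P φ → BooleanCombination P (not φ)
  b-and     : ∀ {φ ψ} → BooleanCombination P φ → BooleanCombination P ψ →
              BooleanCombination P (φ and ψ)
  b-or      : ∀ {φ ψ} → BooleanCombination P φ → BooleanCombination P ψ →
              BooleanCombination P (φ or ψ)
  b-implies : ∀ {φ ψ} → BooleanCombination P φ → BooleanCombination P ψ →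
              BooleanCombination P (φ implies ψ)

Interpretation : ∀ {c} → ℕ → Graph c → Set
Interpretation m G = Fin m → Subset (order G)

Sat : ∀ {c m k} (G : Graph c) → Interpretation m G → Vec (Vertex G) k → Formula c m k → Set
Sat G I ρ true          = ⊤
Sat G I ρ false         = ⊥
Sat G I ρ (x ≐ y)       = lookup ρ x ≡ lookup ρ y
Sat G I ρ (x ~ y)       = Holds (adj G) (lookup ρ x) (lookup ρ y)
Sat G I ρ (col C x)     = lookup ρ x ∈ colour G C
Sat G I ρ (pred U x)    = lookup ρ x ∈ I U
Sat G I ρ (not φ)       = ¬ Sat G I ρ φ
Sat G I ρ (φ and ψ)     = Sat G I ρ φ × Sat G I ρ ψ
Sat G I ρ (φ or ψ)      = Sat G I ρ φ ⊎ Sat G I ρ ψ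
Sat G I ρ (φ implies ψ) = Sat G I ρ φ → Sat G I ρ ψ
Sat G I ρ (ex φ)        = ∃[ v ] Sat G I (v ∷ ρ) φ
Sat G I ρ (all φ)       = ∀ v → Sat G I (v ∷ ρ) φ

_⟨_⟩⊨_ : ∀ {c m} (G : Graph c) → Interpretation m G → Sentence c m → Set
G ⟨ I ⟩⊨ φ = Sat G I [] φ

Touching : ∀ {c} (G : Graph c) → Subset (order G) → Subset (order G) → Set
Touching G A B = Nonempty (A ∩ B) ⊎ ∃[ u ] ∃[ w ] (u ∈ A × w ∈ B × Holds (adj G) u w)

IsTouchingRelation : ∀ {c m} → BoolRel m → (G : Graph c) → Interpretation m G → Set
IsTouchingRelation R G I = ∀ U W → Holds R U W ⇔ Touching G (I U) (I W)

{-# OPTIONS --safe #-}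
module Submission where

-- Write every guarded formula, for each assignment of guards to its free variables, as a disjunction
-- of conjunctions of local formulas. A local formula has a cluster 𝒱 ⊆ 𝒰 of diameter at most 2^q; its
-- quantifiers are guarded by 𝒱 and its free variables have their guards in 𝒱. A binary atom on
-- variables with guards U and W is local with cluster {U, W} if (U, W) ∈ ℛ, and false otherwise. To
-- eliminate ∃ x ∈ U in front of a conjunction, move out the conjuncts whose cluster avoids U, as x
-- does not occur in them. The other clusters all contain U, so their union has diameter at most
-- 2^q + 2^q.

open import Defs
open import Data.Bool.Properties using (T?)
open import Data.Fin using (Fin; zero; suc)
open import Data.Fin.Properties using (_≟_; any?; all?)
open import Data.Fin.Subset using (Subset; _∈_; _∉_; _⊆_; _∪_; ⁅_⁆) renaming (⊤ to full; ⊥ to none)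
open import Data.Fin.Subset.Properties using (_∈?_; ∈⊤; ∉⊥; x∈⁅x⁆; x∈⁅y⁆⇒x≡y; p⊆p∪q; q⊆p∪q; x∈p∪q⁻; x∈p∩q⁺; x∈p∩q⁻)
open import Data.List using (List; []; _∷_; _++_; map; foldr; cartesianProductWith)
open import Data.List.Membership.Propositional using (find; lose)
open import Data.List.Relation.Unary.All using (All; []; _∷_)
import Data.List.Relation.Unary.All as All
import Data.List.Relation.Unary.All.Properties as All
open import Data.List.Relation.Unary.Any using (Any; here; there)
import Data.List.Relation.Unary.Any as Any
import Data.List.Relation.Unary.Any.Properties as Any
open import Data.Nat using (ℕ; zero; suc; _+_; _*_; _^_; _≤_; z≤n; s≤s)
open import Data.Nat.Properties using (≤-refl; ≤-reflexive; ≤-trans; +-comm; +-mono-≤; +-monoˡ-≤; +-monoʳ-≤; *-monoˡ-≤; m≤m+n; anyUpTo?; m⊔n≤o⇒m≤o; m⊔n≤o⇒n≤o; ⊔-lub; +-suc; +-identityʳ; ^-monoʳ-≤; n≤1+n; m^n>0)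
open import Data.Nat.Tactic.RingSolver using (solve-∀)
open import Data.Product using (Σ-syntax; ∃-syntax; _×_; _,_; proj₁; proj₂)
open import Data.Product.Function.NonDependent.Propositional using (_×-⇔_)
open import Data.Sum using (_⊎_; inj₁; inj₂; [_,_]′)
open import Data.Sum.Function.Propositional using (_⊎-⇔_)
open import Data.Unit using (tt)
open import Data.Vec using (Vec; []; _∷_; lookup; tabulate)
open import Data.Vec.Properties using (lookup∘tabulate; lookup⇒[]=; []=⇒lookup)
open import Function using (_∘_; id)
open import Function.Bundles using (_⇔_; mk⇔; module Equivalence)
open import Function.Construct.Composition using () renaming (_⇔-∘_ to infixr 8 _⇔∘_)
open import Function.Related.TypeIsomorphisms using (¬-cong-⇔)
open import Relation.Binary.Definitions using (Symmetric)
open import Relation.Binary.PropositionalEquality using (_≡_; refl; sym; trans; cong; subst; subst₂)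
open import Relation.Nullary using (¬_; Dec; yes; no; does; contradiction)
open import Relation.Nullary.Decidable using (decidable-stable; ¬?; _×-dec_; _⊎-dec_; _→-dec_; map′; dec-true; toWitness; fromWitness; isYes)
open import Relation.Unary using (Pred; Decidable)

open Equivalence using (to; from)

-- Walks

walk-mono : ∀ {n l u v} {V W : Subset n} {E F : BoolRel n} → V ⊆ W →
            (∀ {x y} → Holds E x y → Holds F x y) → Walk V E l u v → Walk W F l u v
walk-mono V⊆W E⊆F (here u∈)     = here (V⊆W u∈)
walk-mono V⊆W E⊆F (step u∈ e p) = step (V⊆W u∈) (E⊆F e) (walk-mono V⊆W E⊆F p)

walk-head : ∀ {n l u v} {V : Subset n} {E} → Walk V E l u v → u ∈ V
walk-head (here u∈)     = u∈
walk-head (step u∈ _ _) = u∈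

walk-trans : ∀ {n k l u v w} {V : Subset n} {E} →
             Walk V E k u v → Walk V E l v w → Walk V E (k + l) u w
walk-trans (here _)      q = q
walk-trans (step u∈ e p) q = step u∈ e (walk-trans p q)

distance-refl : ∀ {n d u} {V : Subset n} {E} → u ∈ V → Distance≤ V E d u u
distance-refl u∈ = 0 , z≤n , here u∈

distance-edge : ∀ {n u v} {V : Subset n} {E : BoolRel n} →
                u ∈ V → v ∈ V → Holds E u v → Distance≤ V E 1 u v
distance-edge u∈ v∈ e = 1 , ≤-refl , step u∈ e (here v∈)

distance-trans : ∀ {n d e u v w} {V : Subset n} {E} →
                 Distance≤ V E d u v → Distance≤ V E e v w → Distance≤ V E (d + e) u w
distance-trans (k , k≤ , p) (l , l≤ , q) = k + l , +-mono-≤ k≤ l≤ , walk-trans p q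

distance-mono : ∀ {n d e u v} {V W : Subset n} {E} → d ≤ e → V ⊆ W →
                Distance≤ V E d u v → Distance≤ W E e u v
distance-mono d≤e V⊆W (l , l≤ , p) = l , ≤-trans l≤ d≤e , walk-mono V⊆W id p

distance-sym : ∀ {n d u v} {V : Subset n} {E} → Symmetric (Holds E) →
               Distance≤ V E d u v → Distance≤ V E d v u
distance-sym {V = V} {E} E-sym (l , l≤ , p) = l , l≤ , reverse p
  where
  reverse : ∀ {l u v} → Walk V E l u v → Walk V E l v u
  reverse (here u∈) = here u∈
  reverse {suc l} {u} {v} (step u∈ e p) =
    subst (λ k → Walk V E k v u) (+-comm l 1)
      (walk-trans (reverse p) (step (walk-head p) (E-sym e) (here u∈)))

walk? : ∀ {n} (V : Subset n) E l u v → Dec (Walk V E l u v)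
walk? V E zero u v =
  map′ (λ { (refl , u∈) → here u∈ }) (λ { (here u∈) → refl , u∈ }) (u ≟ v ×-dec u ∈? V)
walk? V E (suc l) u w =
  map′ (λ { (u∈ , v , e , p) → step u∈ e p }) (λ { (step u∈ e p) → u∈ , _ , e , p })
    (u ∈? V ×-dec any? λ v → T? (E u v) ×-dec walk? V E l v w)

distance? : ∀ {n} (V : Subset n) E d u v → Dec (Distance≤ V E d u v)
distance? V E d u v =
  map′ (λ { (l , s≤s l≤ , p) → l , l≤ , p }) (λ { (l , l≤ , p) → l , s≤s l≤ , p })
    (anyUpTo? (λ l → walk? V E l u v) (suc d))

-- Unions of neighbourhoods

comprehension : ∀ {n p} {P : Pred (Fin n) p} → Decidable P → Subset n
comprehension P? = tabulate (does ∘ P?)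

∈-comprehension⁺ : ∀ {n p} {P : Pred (Fin n) p} (P? : Decidable P) {x} → P x → x ∈ comprehension P?
∈-comprehension⁺ P? {x} px = lookup⇒[]= x _ (trans (lookup∘tabulate _ x) (dec-true (P? x) px))

∈-comprehension⁻ : ∀ {n p} {P : Pred (Fin n) p} (P? : Decidable P) {x} → x ∈ comprehension P? → P x
∈-comprehension⁻ P? {x} x∈ with P? x | trans (sym (lookup∘tabulate (does ∘ P?) x)) ([]=⇒lookup x∈)
... | yes px | _ = px

induced : ∀ {c} (G : Graph c) → Subset (order G) → Subgraph G
induced G V = record
  { vertices  = V
  ; edges     = λ u v → isYes (edge? u v)
  ; edges-sym = λ e → let a , u∈ , v∈ = toWitness e in fromWitness (adj-sym G a , v∈ , u∈)
  ; edges-end = λ e → proj₂ (toWitness e)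
  ; edges-adj = λ e → proj₁ (toWitness e)
  }
  where
  edge? : ∀ u v → Dec (Holds (adj G) u v × u ∈ V × v ∈ V)
  edge? u v = T? (adj G u v) ×-dec u ∈? V ×-dec v ∈? V

module Neighbourhoods
  {c m : ℕ} (R : BoolRel m) (G : Graph c) (I : Interpretation m G)
  (touching : IsTouchingRelation R G I)
  (r : ℕ) (centre : Fin m → Vertex G)
  (bounded : ∀ U {v} → v ∈ I U → InNeighbourhood G r (centre U) v)
  (𝒱 : Subset m) where

  -- Whole balls are taken instead of the sets `I U`: a walk of length at most `r` from a centre may
  -- leave `I U`, but never the ball.
  Near : Vertex G → Set
  Near v = ∃[ U ] (U ∈ 𝒱 × InNeighbourhood G r (centre U) v)

  near? : Decidable Near
  near? v = any? λ U → U ∈? 𝒱 ×-dec distance? full (adj G) r (centre U) v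

  neighbourhoods : Subgraph G
  neighbourhoods = induced G (comprehension near?)

  private
    V = vertices neighbourhoods
    E = edges neighbourhoods

  ⊆-neighbourhoods : ∀ {U} → U ∈ 𝒱 → I U ⊆ V
  ⊆-neighbourhoods U∈ v∈ = ∈-comprehension⁺ near? (_ , U∈ , bounded _ v∈)

  edge-inside : ∀ {u v} → u ∈ V → v ∈ V → Holds (adj G) u v → Holds E u v
  edge-inside u∈ v∈ a = fromWitness (a , u∈ , v∈)

  -- Here `p` is the part already travelled from the centre and `q` the part that remains. The bound
  -- `i + l ≤ r` survives each step, so every vertex met lies within `r` of the centre.
  walk-inside : ∀ {U i l u v} → U ∈ 𝒱 → Walk full (adj G) i (centre U) u → i + l ≤ r →
                Walk full (adj G) l u v → Walk V E l u v
  walk-inside {i = i} U∈ p i+l≤r (here _) =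
    here (∈-comprehension⁺ near? (_ , U∈ , i , ≤-trans (m≤m+n i 0) i+l≤r , p))
  walk-inside {i = i} {suc l} U∈ p i+l≤r (step _ a q) = step u∈ (edge-inside u∈ (walk-head q′) a) q′
    where
    u∈ = ∈-comprehension⁺ near? (_ , U∈ , i , ≤-trans (m≤m+n i (suc l)) i+l≤r , p)
    q′ = walk-inside U∈ (walk-trans p (step ∈⊤ a (here ∈⊤)))
           (subst (_≤ r) (trans (+-suc i l) (cong (_+ l) (sym (+-comm i 1)))) i+l≤r) q

  from-centre : ∀ {U v} → U ∈ 𝒱 → InNeighbourhood G r (centre U) v → Distance≤ V E r (centre U) v
  from-centre U∈ (l , l≤r , p) = l , l≤r , walk-inside U∈ (here ∈⊤) l≤r p

  to-centre : ∀ {U v} → U ∈ 𝒱 → InNeighbourhood G r (centre U) v → Distance≤ V E r v (centre U)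
  to-centre U∈ p = distance-sym (edges-sym neighbourhoods) (from-centre U∈ p)

  -- Go from one centre to a vertex of its set, over at most one edge into the other set, and on to
  -- the other centre.
  touching-centres : ∀ {U W} → U ∈ 𝒱 → W ∈ 𝒱 → Holds R U W →
                     Distance≤ V E (r + 1 + r) (centre U) (centre W)
  touching-centres {U} {W} U∈ W∈ h with to (touching U W) h
  ... | inj₁ (v , v∈) =
    -- A common vertex needs no connecting edge, so the summand 1 is slack.
    distance-trans (distance-mono (m≤m+n r 1) id (from-centre U∈ (bounded U (proj₁ v∈U,W))))
                   (to-centre W∈ (bounded W (proj₂ v∈U,W)))
    where v∈U,W = x∈p∩q⁻ (I U) (I W) v∈
  ... | inj₂ (u , w , u∈ , w∈ , a) =
    distance-trans
      (distance-trans (from-centre U∈ (bounded U u∈))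
                      (distance-edge u∈V w∈V (edge-inside u∈V w∈V a)))
      (to-centre W∈ (bounded W w∈))
    where
    u∈V = ⊆-neighbourhoods U∈ u∈
    w∈V = ⊆-neighbourhoods W∈ w∈

  walk-centres : ∀ {l U W} → Walk 𝒱 R l U W → Distance≤ V E (l * (r + 1 + r)) (centre U) (centre W)
  walk-centres (here U∈)     =
    distance-refl (∈-comprehension⁺ near? (_ , U∈ , distance-refl ∈⊤))
  walk-centres (step U∈ h p) = distance-trans (touching-centres U∈ (walk-head p) h) (walk-centres p)

  -- Each vertex is within `r` of a centre, and a walk of length at most `d` in `R` joins the two
  -- centres at cost `r + 1 + r` per edge. The total is one less than the stated bound.
  neighbourhoods-diameter : ∀ {d} → Diameter≤ 𝒱 R d →
                            Diameter≤ V E ((2 * r + 1) * (d + 1))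
  neighbourhoods-diameter {d} diam u∈ v∈
    with ∈-comprehension⁻ near? u∈ | ∈-comprehension⁻ near? v∈
  ... | U , U∈ , p | W , W∈ , q with diam U∈ W∈
  ... | l , l≤d , w =
    distance-mono (≤-trans (+-monoˡ-≤ r (+-monoʳ-≤ r (*-monoˡ-≤ (r + 1 + r) l≤d))) (total r d)) id
      (distance-trans (distance-trans (to-centre U∈ p) (walk-centres w)) (from-centre W∈ q))
    where
    split-total : ∀ r d → (2 * r + 1) * (d + 1) ≡ (r + d * (r + 1 + r) + r) + 1
    split-total = solve-∀
    total : ∀ r d → r + d * (r + 1 + r) + r ≤ (2 * r + 1) * (d + 1)
    total r d = ≤-trans (m≤m+n _ 1) (≤-reflexive (sym (split-total r d)))

-- Formulas

-- Graphs are finite. This decidability justifies the classical steps below: De Morgan for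
-- conjunctions, material implication, and the universal quantifier as the dual of the existential
-- one.
sat? : ∀ {c m k} (G : Graph c) (I : Interpretation m G) (ρ : Vec (Vertex G) k) φ → Dec (Sat G I ρ φ)
sat? G I ρ true          = yes tt
sat? G I ρ false         = no λ ()
sat? G I ρ (x ≐ y)       = lookup ρ x ≟ lookup ρ y
sat? G I ρ (x ~ y)       = T? _
sat? G I ρ (col C x)     = lookup ρ x ∈? colour G C
sat? G I ρ (pred U x)    = lookup ρ x ∈? I U
sat? G I ρ (not φ)       = ¬? (sat? G I ρ φ)
sat? G I ρ (φ and ψ)     = sat? G I ρ φ ×-dec sat? G I ρ ψ
sat? G I ρ (φ or ψ)      = sat? G I ρ φ ⊎-dec sat? G I ρ ψ
sat? G I ρ (φ implies ψ) = sat? G I ρ φ →-dec sat? G I ρ ψ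
sat? G I ρ (ex φ)        = any? λ v → sat? G I (v ∷ ρ) φ
sat? G I ρ (all φ)       = all? λ v → sat? G I (v ∷ ρ) φ

guarded-mono : ∀ {c m k} {𝒱 𝒲 : Subset m} {φ : Formula c m k} → 𝒱 ⊆ 𝒲 → Guarded 𝒱 φ → Guarded 𝒲 φ
guarded-mono s g-true          = g-true
guarded-mono s g-false         = g-false
guarded-mono s g-eq            = g-eq
guarded-mono s g-edge          = g-edge
guarded-mono s g-col           = g-col
guarded-mono s g-pred          = g-pred
guarded-mono s (g-not g)       = g-not (guarded-mono s g)
guarded-mono s (g-and g h)     = g-and (guarded-mono s g) (guarded-mono s h)
guarded-mono s (g-or g h)      = g-or (guarded-mono s g) (guarded-mono s h)
guarded-mono s (g-implies g h) = g-implies (guarded-mono s g) (guarded-mono s h)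
guarded-mono s (g-ex U∈ g)     = g-ex (s U∈) (guarded-mono s g)
guarded-mono s (g-all U∈ g)    = g-all (s U∈) (guarded-mono s g)

-- Local formulas

module _ {c m : ℕ} where

  -- A variable whose guard is outside the cluster receives no name, so a formula built from a
  -- naming cannot mention it.
  Naming : ∀ {k} → Vec (Fin m) k → Subset m → ℕ → Set
  Naming Γ 𝒱 j = ∀ i → lookup Γ i ∈ 𝒱 → Fin j

  -- Variable i has the guard lookup Γ i. The formula is given for all namings of the variables with
  -- guards in the cluster, which makes substitution and the deletion of unused variables trivial.
  record Local (P : Subset m → Set) (q : ℕ) {k} (Γ : Vec (Fin m) k) : Set where
    field
      cluster   : Subset m
      shape     : P cluster
      form      : ∀ {j} → Naming Γ cluster j → Formula c m j
      rank≤     : ∀ {j} (f : Naming Γ cluster j) → rank (form f) ≤ q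
      guarded   : ∀ {j} (f : Naming Γ cluster j) → Guarded cluster (form f)
      -- Truth depends only on the vertices given to the named variables, not on the names.
      invariant : ∀ {i j} (f : Naming Γ cluster i) (g : Naming Γ cluster j)
                  {G : Graph c} {I : Interpretation m G} {ρ σ} →
                  (∀ x x∈ → lookup ρ (f x x∈) ≡ lookup σ (g x x∈)) →
                  Sat G I ρ (form f) → Sat G I σ (form g)

  open Local

  SatLocal : ∀ {P q k} {Γ : Vec (Fin m) k} (G : Graph c) → Interpretation m G → Vec (Vertex G) k →
             Local P q Γ → Set
  SatLocal G I ρ L = Sat G I ρ (form L λ x _ → x)

  negate : ∀ {P q k} {Γ : Vec (Fin m) k} → Local P q Γ → Local P q Γ
  negate L = record
    { cluster   = cluster L
    ; shape     = shape L
    ; form      = λ f → not (form L f)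
    ; rank≤     = rank≤ L
    ; guarded   = λ f → g-not (guarded L f)
    -- Negation reverses the implication, so invariance is applied with the namings exchanged.
    ; invariant = λ f g eq ¬s s → ¬s (invariant L g f (λ x x∈ → sym (eq x x∈)) s)
    }

  -- A naming for the larger cluster restricts to the smaller one. With the cluster unchanged, this
  -- serves to replace the shape condition or to raise the rank bound.
  enlarge : ∀ {P Q q q′ k} {Γ : Vec (Fin m) k} {𝒱} (L : Local P q Γ) → cluster L ⊆ 𝒱 → Q 𝒱 → q ≤ q′ →
            Local Q q′ Γ
  enlarge {𝒱 = 𝒱} L s Q𝒱 q≤q′ = record
    { cluster   = 𝒱
    ; shape     = Q𝒱
    ; form      = λ f → form L λ x x∈ → f x (s x∈)
    ; rank≤     = λ f → ≤-trans (rank≤ L _) q≤q′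
    ; guarded   = λ f → guarded-mono s (guarded L _)
    ; invariant = λ f g eq → invariant L _ _ λ x x∈ → eq x (s x∈)
    }

  -- The newest variable is never asked for a name, since its guard `U` is not in the cluster.
  skip : ∀ {k j U 𝒱} {Γ : Vec (Fin m) k} → U ∉ 𝒱 → Naming Γ 𝒱 j → Naming (U ∷ Γ) 𝒱 j
  skip U∉ f zero    x∈ = contradiction x∈ U∉
  skip U∉ f (suc x) x∈ = f x x∈

  skip-agree : ∀ {k i j U 𝒱} {Γ : Vec (Fin m) k} {A : Set} (U∉ : U ∉ 𝒱) (f : Naming Γ 𝒱 i)
               (g : Naming (U ∷ Γ) 𝒱 j) {ρ : Vec A i} {σ : Vec A j} →
               (∀ x x∈ → lookup ρ (f x x∈) ≡ lookup σ (g (suc x) x∈)) →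
               ∀ x x∈ → lookup ρ (skip {Γ = Γ} U∉ f x x∈) ≡ lookup σ (g x x∈)
  skip-agree U∉ f g eq zero    x∈ = contradiction x∈ U∉
  skip-agree U∉ f g eq (suc x) x∈ = eq x x∈

  delete : ∀ {P q k U} {Γ : Vec (Fin m) k} (L : Local P q (U ∷ Γ)) → U ∉ cluster L → Local P q Γ
  delete L U∉ = record
    { cluster   = cluster L
    ; shape     = shape L
    ; form      = λ f → form L (skip U∉ f)
    ; rank≤     = λ f → rank≤ L _
    ; guarded   = λ f → guarded L _
    ; invariant = λ f g {ρ = ρ} {σ} eq → invariant L _ _ (skip-agree U∉ f (skip U∉ g) {ρ} {σ} eq)
    }

  delete-sat : ∀ {P q k U} {Γ : Vec (Fin m) k} (L : Local P q (U ∷ Γ)) (U∉ : U ∉ cluster L)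
               {G : Graph c} {I : Interpretation m G} {ρ v} →
               SatLocal G I (v ∷ ρ) L ⇔ SatLocal G I ρ (delete L U∉)
  delete-sat L U∉ {ρ = ρ} {v} = mk⇔
    (invariant L _ _ λ x x∈ → sym (agree x x∈))
    (invariant L _ _ agree)
    where
    agree : ∀ x x∈ → lookup ρ (skip U∉ (λ y _ → y) x x∈) ≡ lookup (v ∷ ρ) x
    agree = skip-agree U∉ (λ y _ → y) (λ y _ → y) {ρ} {v ∷ ρ} λ _ _ → refl

  -- Clusters of bounded diameter and quantification over them

  module _ (R : BoolRel m) where

    Diam : ℕ → Subset m → Set
    Diam q 𝒱 = Diameter≤ 𝒱 R (2 ^ q)

    -- A bound on the radius about `U`. Unlike a bound on the diameter, it is preserved by unions of
    -- any number of sets with this centre.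
    record Centred (U : Fin m) (q : ℕ) (𝒱 : Subset m) : Set where
      field
        centre∈  : U ∈ 𝒱
        outward  : ∀ {W} → W ∈ 𝒱 → Distance≤ 𝒱 R (2 ^ q) U W
        inward   : ∀ {W} → W ∈ 𝒱 → Distance≤ 𝒱 R (2 ^ q) W U

    open Centred

    -- Paths through the centre have length at most `2 ^ q + 2 ^ q`. This is the one place where the
    -- diameter bound doubles.
    centred⇒diam : ∀ {U q 𝒱} → Centred U q 𝒱 → Diam (suc q) 𝒱
    centred⇒diam {q = q} C u∈ v∈ =
      distance-mono (≤-reflexive (cong (2 ^ q +_) (sym (+-identityʳ (2 ^ q))))) id
        (distance-trans (inward C u∈) (outward C v∈))

    diam⇒centred : ∀ {U q 𝒱} → U ∈ 𝒱 → Diam q 𝒱 → Centred U q 𝒱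
    diam⇒centred U∈ D = record { centre∈ = U∈ ; outward = D U∈ ; inward = λ W∈ → D W∈ U∈ }

    diam-suc : ∀ {q 𝒱} → Diam q 𝒱 → Diam (suc q) 𝒱
    diam-suc {q} D u∈ v∈ = distance-mono (^-monoʳ-≤ 2 (n≤1+n q)) id (D u∈ v∈)

    diam-singleton : ∀ {q} U → Diam q ⁅ U ⁆
    diam-singleton U u∈ v∈ with x∈⁅y⁆⇒x≡y U u∈ | x∈⁅y⁆⇒x≡y U v∈
    ... | refl | refl = distance-refl u∈

    diam-pair : ∀ {q U W} → Symmetric (Holds R) → Holds R U W → Diam q (⁅ U ⁆ ∪ ⁅ W ⁆)
    diam-pair {q} {U} {W} R-sym h u∈ v∈ with x∈p∪q⁻ ⁅ U ⁆ ⁅ W ⁆ u∈ | x∈p∪q⁻ ⁅ U ⁆ ⁅ W ⁆ v∈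
    ... | inj₁ p | inj₁ r with refl ← x∈⁅y⁆⇒x≡y U p | refl ← x∈⁅y⁆⇒x≡y U r = distance-refl u∈
    ... | inj₂ p | inj₂ r with refl ← x∈⁅y⁆⇒x≡y W p | refl ← x∈⁅y⁆⇒x≡y W r = distance-refl u∈
    ... | inj₁ p | inj₂ r with refl ← x∈⁅y⁆⇒x≡y U p | refl ← x∈⁅y⁆⇒x≡y W r =
      -- The inequality `m^n>0 2 q` says `1 ≤ 2 ^ q`, which leaves room for one edge.
      distance-mono (m^n>0 2 q) id (distance-edge u∈ v∈ h)
    ... | inj₂ p | inj₁ r with refl ← x∈⁅y⁆⇒x≡y W p | refl ← x∈⁅y⁆⇒x≡y U r =
      distance-mono (m^n>0 2 q) id (distance-edge u∈ v∈ (R-sym h))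

    centred-∪ : ∀ {U q 𝒱 𝒲} → Centred U q 𝒱 → Centred U q 𝒲 → Centred U q (𝒱 ∪ 𝒲)
    centred-∪ {U} {q} {𝒱} {𝒲} A B = record
      { centre∈ = p⊆p∪q 𝒲 (centre∈ A)
      ; outward = λ W∈ → [ (λ p → left (outward A p)) , (λ p → right (outward B p)) ]′ (x∈p∪q⁻ 𝒱 𝒲 W∈)
      ; inward  = λ W∈ → [ (λ p → left (inward A p)) , (λ p → right (inward B p)) ]′ (x∈p∪q⁻ 𝒱 𝒲 W∈)
      }
      where
      left : ∀ {u v} → Distance≤ 𝒱 R (2 ^ q) u v → Distance≤ (𝒱 ∪ 𝒲) R (2 ^ q) u v
      left = distance-mono ≤-refl (p⊆p∪q 𝒲)
      right : ∀ {u v} → Distance≤ 𝒲 R (2 ^ q) u v → Distance≤ (𝒱 ∪ 𝒲) R (2 ^ q) u v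
      right = distance-mono ≤-refl (q⊆p∪q 𝒱 𝒲)

    -- The neutral element for `conjoin`. Even if no conjunct has `U` in its cluster, the quantifier
    -- still asserts that `U` is nonempty, and its guard must belong to a cluster.
    trivial : ∀ {q k U} {Γ : Vec (Fin m) k} → Local (Centred U q) q Γ
    trivial {q} {U = U} = record
      { cluster   = ⁅ U ⁆
      ; shape     = diam⇒centred (x∈⁅x⁆ U) (diam-singleton {q} U)
      ; form      = λ _ → true
      ; rank≤     = λ _ → z≤n
      ; guarded   = λ _ → g-true
      ; invariant = λ _ _ _ _ → tt
      }

    conjoin : ∀ {q k U} {Γ : Vec (Fin m) k} → Local (Centred U q) q Γ → Local (Centred U q) q Γ →
              Local (Centred U q) q Γ
    conjoin {q} {U = U} {Γ} K L = record
      { cluster   = cluster K ∪ cluster L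
      ; shape     = centred
      ; form      = λ f → form K′ f and form L′ f
      ; rank≤     = λ f → ⊔-lub (rank≤ K′ f) (rank≤ L′ f)
      ; guarded   = λ f → g-and (guarded K′ f) (guarded L′ f)
      ; invariant = λ f g eq (s , t) → invariant K′ f g eq s , invariant L′ f g eq t
      }
      where
      centred = centred-∪ (shape K) (shape L)
      K′ L′ : Local (Centred U q) q Γ
      K′ = enlarge K (p⊆p∪q (cluster L)) centred ≤-refl
      L′ = enlarge L (q⊆p∪q (cluster K) (cluster L)) centred ≤-refl

    under : ∀ {k j U 𝒱} {Γ : Vec (Fin m) k} → Naming Γ 𝒱 j → Naming (U ∷ Γ) 𝒱 (suc j)
    under f zero    _  = zero
    under f (suc x) x∈ = suc (f x x∈)

    -- The guard is admissible because the centre belongs to the cluster. The new quantifier raises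
    -- the rank by one, which pays for passing from radius to diameter.
    exists : ∀ {q k U} {Γ : Vec (Fin m) k} → Local (Centred U q) q (U ∷ Γ) → Local (Diam (suc q)) (suc q) Γ
    exists {U = U} {Γ} B = record
      { cluster   = cluster B
      ; shape     = centred⇒diam (shape B)
      ; form      = λ f → ex (pred U zero and form B (under f))
      ; rank≤     = λ f → s≤s (rank≤ B _)
      ; guarded   = λ f → g-ex (centre∈ (shape B)) (guarded B _)
      ; invariant = λ f g eq (v , v∈ , s) →
          v , v∈ , invariant B _ _ (λ { zero _ → refl ; (suc x) x∈ → eq x x∈ }) s
      }

    -- The same vertex is a witness on both sides. Only the namings differ, and they agree at every
    -- variable, so `invariant` applies.
    exists-sat : ∀ {q k U} {Γ : Vec (Fin m) k} (B : Local (Centred U q) q (U ∷ Γ))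
                 {G : Graph c} {I : Interpretation m G} {ρ} →
                 (∃[ v ] (v ∈ I U × SatLocal G I (v ∷ ρ) B)) ⇔ SatLocal G I ρ (exists B)
    exists-sat B = mk⇔
      (λ (v , v∈ , s) → v , v∈ , invariant B _ _ (λ { zero _ → refl ; (suc _) _ → refl }) s)
      (λ (v , v∈ , s) → v , v∈ , invariant B _ _ (λ { zero _ → refl ; (suc _) _ → refl }) s)

    -- Disjunctive normal forms

    Conj : ∀ {k} → ℕ → Vec (Fin m) k → Set
    Conj q Γ = List (Local (Diam q) q Γ)

    DNF : ∀ {k} → ℕ → Vec (Fin m) k → Set
    DNF q Γ = List (Conj q Γ)

    -- All conjuncts that can mention the bound variable must share one witness, so they are merged
    -- into a single formula centred at `U`.
    split : ∀ {k q} U {Γ : Vec (Fin m) k} → Conj q (U ∷ Γ) → Conj (suc q) Γ × Local (Centred U q) q (U ∷ Γ)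
    split U [] = [] , trivial
    split {q = q} U (L ∷ C) with U ∈? cluster L | split U C
    ... | yes U∈ | far , near =
      far , conjoin (enlarge L id (diam⇒centred {q = q} U∈ (shape L)) ≤-refl) near
    ... | no U∉  | far , near =
      enlarge (delete L U∉) id (diam-suc {q} (shape L)) (n≤1+n q) ∷ far , near

    exConj : ∀ {k q} U {Γ : Vec (Fin m) k} → Conj q (U ∷ Γ) → Conj (suc q) Γ
    exConj U C = exists (proj₂ (split U C)) ∷ proj₁ (split U C)

    -- An existential quantifier commutes with disjunction, so each conjunction is treated
    -- separately.
    exDNF : ∀ {k q} U {Γ : Vec (Fin m) k} → DNF q (U ∷ Γ) → DNF (suc q) Γ
    exDNF U = map (exConj U)

    andDNF : ∀ {k q} {Γ : Vec (Fin m) k} → DNF q Γ → DNF q Γ → DNF q Γ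
    andDNF = cartesianProductWith _++_

    notConj : ∀ {k q} {Γ : Vec (Fin m) k} → Conj q Γ → DNF q Γ
    notConj = map λ L → negate L ∷ []

    notDNF : ∀ {k q} {Γ : Vec (Fin m) k} → DNF q Γ → DNF q Γ
    -- The empty disjunction is false; a disjunction whose only member is the empty conjunction is
    -- true.
    notDNF []      = [] ∷ []
    notDNF (C ∷ D) = andDNF (notConj C) (notDNF D)

    module _ (G : Graph c) (I : Interpretation m G) where

      SatConj : ∀ {k q} {Γ : Vec (Fin m) k} → Vec (Vertex G) k → Conj q Γ → Set
      SatConj ρ = All (SatLocal G I ρ)

      SatDNF : ∀ {k q} {Γ : Vec (Fin m) k} → Vec (Vertex G) k → DNF q Γ → Set
      SatDNF ρ = Any (SatConj ρ)

      split-sat : ∀ {k q U} {Γ : Vec (Fin m) k} {ρ v} (C : Conj q (U ∷ Γ)) →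
                  SatConj (v ∷ ρ) C ⇔
                  (SatLocal G I (v ∷ ρ) (proj₂ (split U C)) × SatConj ρ (proj₁ (split U C)))
      split-sat [] = mk⇔ (λ _ → tt , []) (λ _ → [])
      split-sat {U = U} (L ∷ C) with U ∈? cluster L | split U C | split-sat {U = U} C
      ... | yes U∈ | _ | ih = mk⇔
        (λ { (s ∷ ss) → let n , f = to ih ss in (s , n) , f })
        (λ ((s , n) , f) → s ∷ from ih (n , f))
      ... | no U∉  | _ | ih = mk⇔
        (λ { (s ∷ ss) → let n , f = to ih ss in n , to (delete-sat L U∉) s ∷ f })
        (λ { (n , s ∷ f) → from (delete-sat L U∉) s ∷ from ih (n , f) })

      exConj-sat : ∀ {k q U} {Γ : Vec (Fin m) k} {ρ} (C : Conj q (U ∷ Γ)) →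
                   (∃[ v ] (v ∈ I U × SatConj (v ∷ ρ) C)) ⇔ SatConj ρ (exConj U C)
      exConj-sat {U = U} C = mk⇔
        (λ (v , v∈ , s) → let n , f = to (split-sat C) s in
          to (exists-sat (proj₂ (split U C))) (v , v∈ , n) ∷ f)
        (λ { (n ∷ f) → let v , v∈ , s = from (exists-sat (proj₂ (split U C))) n in
          v , v∈ , from (split-sat C) (s , f) })

      exDNF-sat : ∀ {k q U} {Γ : Vec (Fin m) k} {ρ} (D : DNF q (U ∷ Γ)) →
                  (∃[ v ] (v ∈ I U × SatDNF (v ∷ ρ) D)) ⇔ SatDNF ρ (exDNF U D)
      exDNF-sat D = mk⇔
        (λ (v , v∈ , s) → Any.map⁺ (Any.map (λ {C} t → to (exConj-sat C) (v , v∈ , t)) s))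
        (λ s → let C , C∈ , t = find (Any.map⁻ s)
                   v , v∈ , u = from (exConj-sat C) t
               in v , v∈ , lose C∈ u)

      andDNF-sat : ∀ {k q} {Γ : Vec (Fin m) k} {ρ} (D₁ D₂ : DNF q Γ) →
                   (SatDNF ρ D₁ × SatDNF ρ D₂) ⇔ SatDNF ρ (andDNF D₁ D₂)
      andDNF-sat D₁ D₂ = mk⇔
        (λ (s , t) → Any.cartesianProductWith⁺ _++_ All.++⁺ s t)
        (Any.cartesianProductWith⁻ _++_ (λ {C} → All.++⁻ C) D₁ D₂)

      orDNF-sat : ∀ {k q} {Γ : Vec (Fin m) k} {ρ} (D₁ D₂ : DNF q Γ) →
                  (SatDNF ρ D₁ ⊎ SatDNF ρ D₂) ⇔ SatDNF ρ (D₁ ++ D₂)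
      orDNF-sat D₁ D₂ = mk⇔ [ Any.++⁺ˡ , Any.++⁺ʳ D₁ ]′ (Any.++⁻ D₁)

      notConj-sat : ∀ {k q} {Γ : Vec (Fin m) k} {ρ} (C : Conj q Γ) →
                    (¬ SatConj ρ C) ⇔ SatDNF ρ (notConj C)
      notConj-sat {ρ = ρ} C = mk⇔
        -- A failing conjunct is found by deciding each one.
        (λ ¬s → Any.map⁺ (Any.map (_∷ []) (All.¬All⇒Any¬ (λ L → sat? G I ρ (form L λ x _ → x)) C ¬s)))
        (λ s → All.Any¬⇒¬All (Any.map All.head (Any.map⁻ s)))

      notDNF-sat : ∀ {k q} {Γ : Vec (Fin m) k} {ρ} (D : DNF q Γ) →
                   (¬ SatDNF ρ D) ⇔ SatDNF ρ (notDNF D)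
      notDNF-sat []      = mk⇔ (λ _ → here []) (λ _ ())
      notDNF-sat (C ∷ D) =
        andDNF-sat (notConj C) (notDNF D) ⇔∘ (notConj-sat C ×-⇔ notDNF-sat D) ⇔∘
        mk⇔ (λ ¬s → ¬s ∘ here , ¬s ∘ there)
            (λ { (¬c , _) (here s) → ¬c s ; (_ , ¬d) (there s) → ¬d s })

    -- From normal forms back to sentences

    literals : ∀ {q} → Conj q [] → Sentence c m
    literals = foldr (λ L ψ → form L (λ x _ → x) and ψ) true

    toSentence : ∀ {q} → DNF q [] → Sentence c m
    toSentence = foldr (λ C ψ → literals C or ψ) false

    toSentence-sat : ∀ {q G I} (D : DNF q []) → SatDNF G I [] D ⇔ (G ⟨ I ⟩⊨ toSentence D)
    toSentence-sat [] = mk⇔ (λ ()) (λ ())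
    toSentence-sat {G = G} {I} (C ∷ D) =
      (literals-sat C ⊎-⇔ toSentence-sat D) ⇔∘ mk⇔ Any.toSum Any.fromSum
      where
      literals-sat : ∀ C → SatConj G I [] C ⇔ (G ⟨ I ⟩⊨ literals C)
      literals-sat []      = mk⇔ (λ _ → tt) (λ _ → [])
      literals-sat (L ∷ C) = mk⇔ (λ { (s ∷ ss) → s , to (literals-sat C) ss })
                                 (λ (s , ss) → s ∷ from (literals-sat C) ss)

    LocalSentence : ℕ → Sentence c m → Set
    LocalSentence q ψ = rank ψ ≤ q × (Σ[ 𝒱 ∈ Subset m ] (Guarded 𝒱 ψ × Diameter≤ 𝒱 R (2 ^ q)))

    toSentence-local : ∀ {q} (D : DNF q []) → BooleanCombination (LocalSentence q) (toSentence D)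
    -- The constant is itself a base sentence, guarded by the empty cluster, whose diameter
    -- condition is vacuous.
    toSentence-local []      = b-base (z≤n , none , g-false , λ u∈ _ → contradiction u∈ ∉⊥)
    toSentence-local {q} (C ∷ D) = b-or (literals-local C) (toSentence-local D)
      where
      literals-local : ∀ C → BooleanCombination (LocalSentence q) (literals C)
      literals-local []      = b-base (z≤n , none , g-true , λ u∈ _ → contradiction u∈ ∉⊥)
      literals-local (L ∷ C) =
        b-and (b-base (rank≤ L _ , cluster L , guarded L _ , shape L)) (literals-local C)

    -- Atoms and the decomposition of guarded formulas

    module _ (R-sym : Symmetric (Holds R)) where

      -- A colour or predicate of x is treated as a binary atom on (x, x): the value of x in the guard U
      -- witnesses (U, U) ∈ ℛ.
      data Atom : Set where
        eq edge : Atom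
        hue     : Fin c → Atom
        symbol  : Fin m → Atom

      atom : ∀ {k} → Atom → Fin k → Fin k → Formula c m k
      atom eq         x y = x ≐ y
      atom edge       x y = x ~ y
      atom (hue C)    x y = col C x
      atom (symbol U) x y = pred U x

      atom-rank : ∀ {q k} a (x y : Fin k) → rank (atom a x y) ≤ q
      atom-rank eq         x y = z≤n
      atom-rank edge       x y = z≤n
      atom-rank (hue C)    x y = z≤n
      atom-rank (symbol U) x y = z≤n

      atom-guarded : ∀ {k 𝒱} a (x y : Fin k) → Guarded 𝒱 (atom a x y)
      atom-guarded eq         x y = g-eq
      atom-guarded edge       x y = g-edge
      atom-guarded (hue C)    x y = g-col
      atom-guarded (symbol U) x y = g-pred

      atom-invariant : ∀ {i j} a {x y : Fin i} {x′ y′ : Fin j} {G : Graph c} {I : Interpretation m G} {ρ σ} →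
                       lookup ρ x ≡ lookup σ x′ → lookup ρ y ≡ lookup σ y′ →
                       Sat G I ρ (atom a x y) → Sat G I σ (atom a x′ y′)
      atom-invariant eq         {G = G} p q s = trans (sym p) (trans s q)
      atom-invariant edge       {G = G} p q s = subst₂ (Holds (adj G)) p q s
      atom-invariant (hue C)    {G = G} p q s = subst (_∈ colour G C) p s
      atom-invariant (symbol U) {I = I} p q s = subst (_∈ I U) p s

      atomDNF : ∀ {q k} {Γ : Vec (Fin m) k} → Atom → Fin k → Fin k → DNF q Γ
      atomDNF {q} {Γ = Γ} a x y with T? (R (lookup Γ x) (lookup Γ y))
      ... | no _  = []
      ... | yes h = (record
        { cluster   = ⁅ lookup Γ x ⁆ ∪ ⁅ lookup Γ y ⁆
        ; shape     = diam-pair {q} R-sym h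
        ; form      = λ f → atom a (f x x∈) (f y y∈)
        ; rank≤     = λ f → atom-rank a _ _
        ; guarded   = λ f → atom-guarded a _ _
        ; invariant = λ f g eq → atom-invariant a (eq x x∈) (eq y y∈)
        } ∷ []) ∷ []
        where
        x∈ = p⊆p∪q ⁅ lookup Γ y ⁆ (x∈⁅x⁆ (lookup Γ x))
        y∈ = q⊆p∪q ⁅ lookup Γ x ⁆ ⁅ lookup Γ y ⁆ (x∈⁅x⁆ (lookup Γ y))

      -- Since `q` is only an upper bound on the rank, both arguments of a connective are decomposed
      -- at the same `q`; each quantifier lowers it by one.
      decompose : ∀ {q k} {φ : Formula c m k} (Γ : Vec (Fin m) k) → Guarded full φ → rank φ ≤ q → DNF q Γ
      decompose Γ g-true               rk = [] ∷ []
      decompose Γ g-false              rk = []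
      decompose Γ (g-eq {x} {y})       rk = atomDNF eq x y
      decompose Γ (g-edge {x} {y})     rk = atomDNF edge x y
      decompose Γ (g-col {C} {x})      rk = atomDNF (hue C) x x
      decompose Γ (g-pred {U} {x})     rk = atomDNF (symbol U) x x
      decompose Γ (g-not g)            rk = notDNF (decompose Γ g rk)
      decompose Γ (g-and {φ} {ψ} g h)  rk =
        andDNF (decompose Γ g (m⊔n≤o⇒m≤o _ (rank ψ) rk)) (decompose Γ h (m⊔n≤o⇒n≤o (rank φ) _ rk))
      decompose Γ (g-or {φ} {ψ} g h)   rk =
        decompose Γ g (m⊔n≤o⇒m≤o _ (rank ψ) rk) ++ decompose Γ h (m⊔n≤o⇒n≤o (rank φ) _ rk)
      decompose Γ (g-implies {φ} {ψ} g h) rk =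
        notDNF (decompose Γ g (m⊔n≤o⇒m≤o _ (rank ψ) rk)) ++ decompose Γ h (m⊔n≤o⇒n≤o (rank φ) _ rk)
      decompose Γ (g-ex {U} _ g)       (s≤s rk) = exDNF U (decompose (U ∷ Γ) g rk)
      -- A guarded universal quantifier is the negation of the existential one, with the same guard,
      -- over the negated body.
      decompose Γ (g-all {U} _ g)      (s≤s rk) = notDNF (exDNF U (notDNF (decompose (U ∷ Γ) g rk)))

      -- Correctness of the decomposition

      module _ (G : Graph c) (I : Interpretation m G) (touching : IsTouchingRelation R G I) where

        -- Atoms on unrelated guards are replaced by false, which is sound only for values inside
        -- those guards.
        Respects : ∀ {k} → Vec (Fin m) k → Vec (Vertex G) k → Set
        Respects Γ ρ = ∀ x → lookup ρ x ∈ I (lookup Γ x)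

        respects-∷ : ∀ {k U v} {Γ : Vec (Fin m) k} {ρ} → v ∈ I U → Respects Γ ρ → Respects (U ∷ Γ) (v ∷ ρ)
        respects-∷ v∈ ok zero    = v∈
        respects-∷ v∈ ok (suc x) = ok x

        -- If the guards are unrelated, a true atom would make their sets touch and hence relate
        -- them in `R`; so the atom is false, as is the empty disjunction.
        atomDNF-sat : ∀ {q k} {Γ : Vec (Fin m) k} {ρ} a x y →
                      (Sat G I ρ (atom a x y) → Touching G (I (lookup Γ x)) (I (lookup Γ y))) →
                      Sat G I ρ (atom a x y) ⇔ SatDNF G I ρ (atomDNF {q} {Γ = Γ} a x y)
        atomDNF-sat {Γ = Γ} a x y touch with T? (R (lookup Γ x) (lookup Γ y))
        ... | yes _ = mk⇔ (λ s → here (s ∷ [])) (λ { (here (s ∷ [])) → s })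
        ... | no ¬h = mk⇔ (λ s → contradiction (from (touching _ _) (touch s)) ¬h) (λ ())

        decompose-sat : ∀ {q k} {φ : Formula c m k} {Γ : Vec (Fin m) k} {ρ}
                        (g : Guarded full φ) (rk : rank φ ≤ q) → Respects Γ ρ →
                        Sat G I ρ φ ⇔ SatDNF G I ρ (decompose Γ g rk)
        decompose-sat g-true           rk ok = mk⇔ (λ _ → here []) (λ _ → tt)
        decompose-sat g-false          rk ok = mk⇔ (λ ()) (λ ())
        -- Equal values are a common vertex of both guards, and an edge joins the two guards. A
        -- unary atom has its single vertex in the guard paired with itself.
        decompose-sat {Γ = Γ} (g-eq {x} {y})   rk ok = atomDNF-sat eq x y λ s →
          inj₁ (_ , x∈p∩q⁺ (ok x , subst (_∈ I (lookup Γ y)) (sym s) (ok y)))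
        decompose-sat (g-edge {x} {y}) rk ok = atomDNF-sat edge x y λ s → inj₂ (_ , _ , ok x , ok y , s)
        decompose-sat (g-col {C} {x})  rk ok =
          atomDNF-sat (hue C) x x λ _ → inj₁ (_ , x∈p∩q⁺ (ok x , ok x))
        decompose-sat (g-pred {U} {x}) rk ok =
          atomDNF-sat (symbol U) x x λ _ → inj₁ (_ , x∈p∩q⁺ (ok x , ok x))
        decompose-sat {Γ = Γ} (g-not g) rk ok =
          notDNF-sat G I (decompose Γ g rk) ⇔∘ ¬-cong-⇔ (decompose-sat g rk ok)
        decompose-sat (g-and g h) rk ok =
          andDNF-sat G I _ _ ⇔∘ (decompose-sat g _ ok ×-⇔ decompose-sat h _ ok)
        decompose-sat (g-or g h) rk ok =
          orDNF-sat G I _ _ ⇔∘ (decompose-sat g _ ok ⊎-⇔ decompose-sat h _ ok)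
        decompose-sat {ρ = ρ} (g-implies {φ} {ψ} g h) rk ok =
          orDNF-sat G I _ _ ⇔∘
          ((notDNF-sat G I _ ⇔∘ ¬-cong-⇔ (decompose-sat g _ ok)) ⊎-⇔ decompose-sat h _ ok) ⇔∘
          mk⇔ material [ (λ ¬s s → contradiction s ¬s) , (λ t _ → t) ]′
          where
          material : (Sat G I ρ φ → Sat G I ρ ψ) → ¬ Sat G I ρ φ ⊎ Sat G I ρ ψ
          material f with sat? G I ρ φ
          ... | yes s = inj₂ (f s)
          ... | no ¬s = inj₁ ¬s
        decompose-sat {Γ = Γ} (g-ex {U} _ g) (s≤s rk) ok =
          exDNF-sat G I (decompose (U ∷ Γ) g rk) ⇔∘
          mk⇔ (λ (v , v∈ , s) → v , v∈ , to (decompose-sat g rk (respects-∷ v∈ ok)) s)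
              (λ (v , v∈ , s) → v , v∈ , from (decompose-sat g rk (respects-∷ v∈ ok)) s)
        decompose-sat {Γ = Γ} {ρ} (g-all {U} {φ} _ g) (s≤s rk) ok =
          notDNF-sat G I _ ⇔∘ ¬-cong-⇔ (exDNF-sat G I (notDNF (decompose (U ∷ Γ) g rk))) ⇔∘
          mk⇔ (λ all (v , v∈ , t) →
                 from (notDNF-sat G I _) t (to (decompose-sat g rk (respects-∷ v∈ ok)) (all v v∈)))
              -- The absence of a counterexample gives the body up to double negation, which
              -- decidability removes.
              (λ ¬ex v v∈ → decidable-stable (sat? G I (v ∷ ρ) φ) λ ¬s →
                 ¬ex (v , v∈ , to (notDNF-sat G I _)
                                  (¬s ∘ from (decompose-sat g rk (respects-∷ v∈ ok)))))

theorem5p5 : Σ[ compute ∈ (∀ {c m} (q : ℕ) (φ : Sentence c m) → Guarded full φ → rank φ ≤ q →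
    (R : BoolRel m) → Symmetric (Holds R) → Sentence c m) ]
    (∀ {c m} (q : ℕ) (φ : Sentence c m) (g : Guarded full φ) (rk : rank φ ≤ q)
    (R : BoolRel m) (R-sym : Symmetric (Holds R)) →
    let φR = compute q φ g rk R R-sym in
    (∀ (G : Graph c) (I : Interpretation m G) → IsTouchingRelation R G I →
    (G ⟨ I ⟩⊨ φ) ⇔ (G ⟨ I ⟩⊨ φR))
    × BooleanCombination
    (λ ψ → rank ψ ≤ q ×
    (Σ[ 𝒰′ ∈ Subset m ] (Guarded 𝒰′ ψ × Diameter≤ 𝒰′ R (2 ^ q))))
    φR
    × (∀ (G : Graph c) (I : Interpretation m G) → IsTouchingRelation R G I →
    ∀ (r : ℕ) → (∀ U → ∃[ a ] (∀ {v} → v ∈ I U → InNeighbourhood G r a v)) →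
    ∀ (𝒰′ : Subset m) → Diameter≤ 𝒰′ R (2 ^ q) →
    Σ[ H ∈ Subgraph G ]
    ((∀ {U} → U ∈ 𝒰′ → I U ⊆ vertices H)
    × Diameter≤ (vertices H) (edges H) ((2 * r + 1) * (2 ^ q + 1)))))
theorem5p5 =
  (λ q φ g rk R R-sym → toSentence R (decompose R R-sym [] g rk)) ,
  λ q φ g rk R R-sym →
    let D = decompose R R-sym [] g rk in
    -- A sentence has no free variables, so the condition that values respect their guards is
    -- vacuous.
    (λ G I touching → toSentence-sat R D ⇔∘ decompose-sat R R-sym G I touching g rk λ ()) ,
    toSentence-local R D ,
    λ G I touching r bounded 𝒱 diam →
      let open Neighbourhoods R G I touching r (λ U → proj₁ (bounded U)) (λ U → proj₂ (bounded U)) 𝒱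
      in neighbourhoods , ⊆-neighbourhoods , neighbourhoods-diameter diam
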